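{- Let $k\ge 2$ and let $G$ be a connected $k$-uniform hypergraph with $n$ vertices, with vertex set $[n]=\{1,\dots,n\}$. Let $\mathbb{A}$ and $\mathbb{D}$ be the adjacency tensor and the degree diagonal tensor of $G$, and let $\mathbb{L}=\mathbb{D}-\mathbb{A}$ and $\mathbb{Q}=\mathbb{D}+\mathbb{A}$ be the Laplacian tensor and the signless Laplacian tensor of $G$, respectively. Then the following three conditions are equivalent: (1) There exists some diagonal matrix $P$ of order $n$ with all the diagonal entries $\pm 1$ and $P\ne -I_n$ such that $\mathbb{L}=P^{ -(k-1)}\mathbb{Q}P$. (2) There exists some diagonal matrix $P$ of order $n$ with all the diagonal entries $\pm 1$ and $P\ne -I_n$ such that $\mathbb{A}=-P^{ -(k-1)}\mathbb{A}P$. (3) $k$ is even and $G$ is odd-bipartite.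
   Context: A $k$-uniform hypergraph $G=(V,E)$ has a finite nonempty vertex set $V$ and a set $E$ of edges, each edge being a $k$-element subset of $V$. $G$ is connected if any two distinct vertices can be joined by a sequence of edges in which consecutive edges intersect, the first edge containing one of the vertices and the last edge containing the other. $I_n$ is the identity matrix of order $n$. An order $k$ dimension $n$ tensor is an array $\mathbb{T}=(t_{i_1\cdots i_k})$ with $i_1,\dots,i_k\in[n]$; tensors here have real entries. The adjacency tensor $\mathbb{A}$ of $G$ (with $V=[n]$) is the order $k$ dimension $n$ tensor with $a_{i_1\cdots i_k}=\frac{1}{(k-1)!}$ if $\{i_1,\dots,i_k\}\in E$ (so the $i_j$ are distinct) and $0$ otherwise. The degree diagonal tensor $\mathbb{D}$ is the order $k$ dimension $n$ tensor with $d_{i\cdots i}$ equal to the degree of $i$ (the number of edges containing $i$) and all other entries $0$. For an order $k$ dimension $n$ tensor $\mathbb{T}$ and a nonsingular $n\times n$ diagonal matrix $P=\mathrm{diag}(p_{11},\dots,p_{nn})$, $P^{ -(k-1)}\mathbb{T}P$ denotes the order $k$ dimension $n$ tensor with entries $(P^{ -(k-1)}\mathbb{T}P)_{i_1\cdots i_k}=p_{i_1i_1}^{ -(k-1)}p_{i_2i_2}\cdots p_{i_ki_k}\,t_{i_1\cdots i_k}$. A $k$-uniform hypergraph $G=(V,E)$ is odd-bipartite if $k$ is even and there exists some proper subset $V_1$ of $V$ such that each edge of $G$ contains an odd number of vertices in $V_1$.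
   Formalization: The case n = 1 with k odd is excluded: there G has no edges and is vacuously connected, so A = D = 0 and conditions (1) and (2) hold with P = I_1, while (3) fails because k is odd. -}

module Defs where

open import Data.Bool using (if_then_else_)
import Data.Bool.Properties as Bool
open import Data.Fin using (Fin)
import Data.Fin.Properties as Fin
open import Data.Fin.Subset using (Subset; _∈_; _∩_; _∪_; _⊂_; ⊤; ⊥; ⁅_⁆; ∣_∣; Nonempty)
open import Data.Fin.Subset.Properties using (_∈?_)
open import Data.Integer using (+_)
open import Data.List using (List; length; filter)
import Data.List.Membership.Propositional as List
import Data.List.Membership.DecPropositional as DecMembership
open import Data.List.Relation.Unary.Unique.Propositional using (Unique)
open import Data.Nat as ℕ using (ℕ; _∸_; _!)
open import Data.Nat.Divisibility using (_∣_; _∤_)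
open import Data.Nat.Properties using (_!≢0)
open import Data.Product using (Σ; ∃-syntax; _×_; proj₁)
open import Data.Rational as ℚ using (ℚ; 0ℚ; 1ℚ; _/_; 1/_)
open import Data.Sum using (_⊎_)
open import Data.Vec using (Vec; []; _∷_; foldr′; map)
import Data.Vec.Properties as Vec
open import Data.Vec.Relation.Unary.All using (all?)
open import Algebra.Definitions.RawSemiring ℚ.+-*-rawSemiring using (_^_)
open import Relation.Binary.Construct.Closure.ReflexiveTransitive using (Star)
open import Relation.Binary.PropositionalEquality using (_≡_; _≢_)
open import Relation.Nullary using (Dec; does)

private
  variable
    k n : ℕ

-- The duplicate-free list `edges` represents a finite set; its order is
-- irrelevant to everything below.
record Hypergraph (k n : ℕ) : Set where
  field
    vertices-nonempty : ℕ.NonZero n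
    edges             : List (Subset n)
    edges-distinct    : Unique edges
    edges-uniform     : ∀ {e} → e List.∈ edges → ∣ e ∣ ≡ k

open Hypergraph public

Edge : Hypergraph k n → Set
Edge {n = n} G = Σ (Subset n) (List._∈ edges G)

Intersecting : (G : Hypergraph k n) → Edge G → Edge G → Set
Intersecting G e f = Nonempty (proj₁ e ∩ proj₁ f)

Connected : Hypergraph k n → Set
Connected {n = n} G =
  ∀ (u v : Fin n) → u ≢ v →
  ∃[ e ] ∃[ f ] (u ∈ proj₁ e × Star (Intersecting G) e f × v ∈ proj₁ f)

degree : Hypergraph k n → Fin n → ℕ
degree G i = length (filter (i ∈?_) (edges G))

OddBipartite : Hypergraph k n → Set
OddBipartite {k} {n} G =
  2 ∣ k ×
  ∃[ V₁ ] (V₁ ⊂ ⊤ {n = n} × (∀ {e} → e List.∈ edges G → 2 ∤ ∣ e ∩ V₁ ∣))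

-- All the tensors and matrices involved have rational entries, so ℚ serves
-- as the field of scalars.
Tensor : ℕ → ℕ → Set
Tensor k n = Vec (Fin n) k → ℚ

infixl 6 _+ᵗ_ _-ᵗ_
infix  8 -ᵗ_

_+ᵗ_ : Tensor k n → Tensor k n → Tensor k n
(S +ᵗ T) is = S is ℚ.+ T is

-ᵗ_ : Tensor k n → Tensor k n
(-ᵗ T) is = ℚ.- T is

_-ᵗ_ : Tensor k n → Tensor k n → Tensor k n
(S -ᵗ T) is = S is ℚ.- T is

-- The set {i₁, …, iₖ}.
support : Vec (Fin n) k → Subset n
support []       = ⊥
support (i ∷ is) = ⁅ i ⁆ ∪ support is

isEdge? : (G : Hypergraph k n) (s : Subset n) → Dec (s List.∈ edges G)
isEdge? G s = DecMembership._∈?_ (Vec.≡-dec Bool._≟_) s (edges G)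

adjacency : Hypergraph k n → Tensor k n
adjacency {k} G is =
  if does (isEdge? G (support is))
  then _/_ (+ 1) ((k ∸ 1) !) {{(k ∸ 1) !≢0}}
  else 0ℚ

-- Here and in `scale`, the clause for [] (order 0) is an irrelevant convention.
degreeTensor : Hypergraph k n → Tensor k n
degreeTensor G []       = 0ℚ
degreeTensor G (i ∷ is) =
  if does (all? (i Fin.≟_) is) then + degree G i / 1 else 0ℚ

laplacian : Hypergraph k n → Tensor k n
laplacian G = degreeTensor G -ᵗ adjacency G

signlessLaplacian : Hypergraph k n → Tensor k n
signlessLaplacian G = degreeTensor G +ᵗ adjacency G

Matrix : ℕ → Set
Matrix n = Fin n → Fin n → ℚ

infix 4 _≈ᴹ_

_≈ᴹ_ : Matrix n → Matrix n → Set
M ≈ᴹ N = ∀ i j → M i j ≡ N i j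

-ᴹ_ : Matrix n → Matrix n
(-ᴹ M) i j = ℚ.- M i j

identity : Matrix n
identity i j = if does (i Fin.≟ j) then 1ℚ else 0ℚ

record NonsingularDiagonal (n : ℕ) : Set where
  field
    matrix       : Matrix n
    off-diagonal : ∀ {i j} → i ≢ j → matrix i j ≡ 0ℚ
    nonsingular  : ∀ i → ℚ.NonZero (matrix i i)

open NonsingularDiagonal public

diagonal : NonsingularDiagonal n → Fin n → ℚ
diagonal P i = matrix P i i

diagonal⁻¹ : NonsingularDiagonal n → Fin n → ℚ
diagonal⁻¹ P i = 1/_ (diagonal P i) {{nonsingular P i}}

-- Nonsingularity is automatic for such matrices, so bundling it in P does not
-- restrict the ±1 diagonal matrices considered.
SignDiagonal : NonsingularDiagonal n → Set
SignDiagonal P = ∀ i → diagonal P i ≡ 1ℚ ⊎ diagonal P i ≡ ℚ.- 1ℚ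

-- scale P T is the tensor P^{-(k-1)} T P.
scale : NonsingularDiagonal n → Tensor k n → Tensor k n
scale         P T []       = T []
scale {k = k} P T (i ∷ is) =
  diagonal⁻¹ P i ^ (k ∸ 1)
    ℚ.* foldr′ ℚ._*_ 1ℚ (map (diagonal P) is)
    ℚ.* T (i ∷ is)

-- Let V be the set of i with P_ii = -1. Scaling by P multiplies the entry
-- (i, i₂, …, iₖ) by the sign (-1)^((k-1)[i ∈ V] + [i₂ ∈ V] + … + [iₖ ∈ V]).
-- This sign is +1 on the diagonal, so 𝔻 is invariant and (1) and (2) agree for
-- the same P; both say that the exponent is odd on every edge. For even k the
-- exponent has the parity of |e ∩ V|, which gives (3), and P ≠ -I says that V is
-- proper. For odd k the condition fails on any edge, and an edge exists by
-- connectedness.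
module Submission where

open import Defs
open import Data.Nat using (ℕ; _≤_)
open import Data.Nat.Divisibility using (_∣_)
open import Data.Product using (∃-syntax; _×_)
open import Data.Sum using (_⊎_)
open import Function.Bundles using (_⇔_)
open import Relation.Binary.PropositionalEquality using (_≗_)
open import Relation.Nullary using (¬_)

open import Algebra.Bundles using (module CommutativeRing)
import Algebra.Properties.Group as GroupProperties
import Algebra.Properties.Semiring.Exp as Exp
open import Data.Bool using (true; false; if_then_else_)
open import Data.Fin using (Fin; zero; suc)
import Data.Fin.Properties as Fin
open import Data.Fin.Subset using (Subset; _∈_; _∉_; _∩_; _∪_; _⊆_; _⊂_; ⊤; ⊥; ⁅_⁆; ∣_∣; _-_)
open import Data.Fin.Subset.Properties as Subset using (_∈?_)
import Data.Integer as ℤ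
import Data.List.Membership.Propositional as List
open import Data.Nat using (zero; suc; _+_; _*_; _!; s≤s)
open import Data.Nat.Divisibility
  using (_∤_; _∣?_; divides; divides-refl; ∣m∣n⇒∣m+n; ∣m+n∣m⇒∣n; ∣1⇒≡1; ∣n⇒∣m*n)
open import Data.Nat.Properties as ℕ using (_!≢0)
open import Data.Nat.Tactic.RingSolver using (solve-∀)
open import Data.Product using (Σ-syntax; _,_; proj₁; proj₂)
open import Data.Rational as ℚ using (ℚ; 0ℚ; 1ℚ)
open import Algebra.Definitions.RawSemiring ℚ.+-*-rawSemiring using (_^_)
import Data.Rational.Properties as ℚ
open import Data.Sum using (inj₁; inj₂; [_,_]′)
open import Data.Vec using (Vec; []; _∷_; lookup; tabulate; map; sum; foldr′; here; there)
open import Data.Vec.Properties using (lookup∘tabulate; []=⇒lookup; lookup⇒[]=)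
open import Data.Vec.Relation.Unary.All using (All; []; _∷_; all?)
open import Function using (_∘_; case_of_; mk⇔; module Equivalence)
open import Function.Construct.Composition using (_⇔-∘_)
open import Relation.Binary.PropositionalEquality
  using (_≡_; _≢_; refl; sym; trans; cong; cong₂; subst; module ≡-Reasoning)
open import Relation.Nullary using (does; yes; no; contradiction)
open import Relation.Nullary.Decidable using (dec-true; dec-false)

private
  variable
    k n : ℕ

-- Parity of natural numbers.

2∣m+m : ∀ m → 2 ∣ m + m
2∣m+m m = divides m (m+m≡m*2 m)
  where
  m+m≡m*2 : ∀ m → m + m ≡ m * 2
  m+m≡m*2 = solve-∀

2∣m⊎2∣1+m : ∀ m → (2 ∣ m) ⊎ (2 ∣ suc m)
2∣m⊎2∣1+m zero    = inj₁ (divides 0 refl)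
2∣m⊎2∣1+m (suc m) = [ inj₂ ∘ ∣m∣n⇒∣m+n (divides 1 refl) , inj₁ ]′ (2∣m⊎2∣1+m m)

2∤m⇒2∣1+m : ∀ {m} → 2 ∤ m → 2 ∣ suc m
2∤m⇒2∣1+m {m} 2∤m = [ (λ 2∣m → contradiction 2∣m 2∤m) , (λ 2∣1+m → 2∣1+m) ]′ (2∣m⊎2∣1+m m)

-- Counting the entries of an index tuple that lie in a vertex set.

indicator : Subset n → Fin n → ℕ
indicator V i = if lookup V i then 1 else 0

multiplicity : Subset n → Vec (Fin n) k → ℕ
multiplicity V is = sum (map (indicator V) is)

indicator-∈ : ∀ {V : Subset n} {i} → i ∈ V → indicator V i ≡ 1
indicator-∈ i∈V = cong (if_then 1 else 0) ([]=⇒lookup i∈V)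

indicator-∉ : ∀ {V : Subset n} {i} → i ∉ V → indicator V i ≡ 0
indicator-∉ {V = V} {i} i∉V with lookup V i in eq
... | true  = contradiction (lookup⇒[]= i V eq) i∉V
... | false = refl

∣[⁅i⁆∪s]∩V∣ : ∀ (V : Subset n) {i s} → i ∉ s → ∣ (⁅ i ⁆ ∪ s) ∩ V ∣ ≡ indicator V i + ∣ s ∩ V ∣
∣[⁅i⁆∪s]∩V∣ V {zero} {true ∷ s} i∉s = contradiction here i∉s
∣[⁅i⁆∪s]∩V∣ (true ∷ V) {zero} {false ∷ s} i∉s = cong (λ t → suc ∣ t ∩ V ∣) (Subset.∪-identityˡ s)
∣[⁅i⁆∪s]∩V∣ (false ∷ V) {zero} {false ∷ s} i∉s = cong (λ t → ∣ t ∩ V ∣) (Subset.∪-identityˡ s)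
∣[⁅i⁆∪s]∩V∣ (true ∷ V) {suc i} {true ∷ s} i∉s =
  trans (cong suc (∣[⁅i⁆∪s]∩V∣ V (i∉s ∘ there))) (sym (ℕ.+-suc _ _))
∣[⁅i⁆∪s]∩V∣ (false ∷ V) {suc i} {true ∷ s} i∉s = ∣[⁅i⁆∪s]∩V∣ V (i∉s ∘ there)
∣[⁅i⁆∪s]∩V∣ (_ ∷ V) {suc i} {false ∷ s} i∉s = ∣[⁅i⁆∪s]∩V∣ V (i∉s ∘ there)

∣⁅i⁆∪s∣ : ∀ {i} {s : Subset n} → i ∉ s → ∣ ⁅ i ⁆ ∪ s ∣ ≡ suc ∣ s ∣
∣⁅i⁆∪s∣ {i = i} {s} i∉s = begin
  ∣ ⁅ i ⁆ ∪ s ∣             ≡⟨ cong ∣_∣ (Subset.∩-identityʳ (⁅ i ⁆ ∪ s)) ⟨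
  ∣ (⁅ i ⁆ ∪ s) ∩ ⊤ ∣       ≡⟨ ∣[⁅i⁆∪s]∩V∣ ⊤ i∉s ⟩
  indicator ⊤ i + ∣ s ∩ ⊤ ∣ ≡⟨ cong₂ _+_ (indicator-∈ (Subset.∈⊤ {x = i})) (cong ∣_∣ (Subset.∩-identityʳ s)) ⟩
  suc ∣ s ∣                 ∎
  where open ≡-Reasoning

i∈s⇒⁅i⁆∪s≡s : ∀ {i} {s : Subset n} → i ∈ s → ⁅ i ⁆ ∪ s ≡ s
i∈s⇒⁅i⁆∪s≡s {i = zero}  {_ ∷ s} here        = cong (true ∷_) (Subset.∪-identityˡ s)
i∈s⇒⁅i⁆∪s≡s {i = suc i} {b ∷ s} (there i∈s) = cong (b ∷_) (i∈s⇒⁅i⁆∪s≡s i∈s)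

∣support∣≤length : ∀ (is : Vec (Fin n) k) → ∣ support is ∣ ≤ k
∣support∣≤length {n} []   = ℕ.≤-reflexive (Subset.∣⊥∣≡0 n)
∣support∣≤length (i ∷ is) with i ∈? support is
... | yes i∈s = ℕ.m≤n⇒m≤1+n (subst (_≤ _) (sym (cong ∣_∣ (i∈s⇒⁅i⁆∪s≡s i∈s))) (∣support∣≤length is))
... | no  i∉s = subst (_≤ _) (sym (∣⁅i⁆∪s∣ i∉s)) (s≤s (∣support∣≤length is))

-- The hypothesis `∣ support is ∣ ≡ k` says that the entries are distinct: a repeated entry would
-- leave a support of fewer than `k` elements. Each entry in `V` is then counted once on both sides.
∣support∩V∣ : ∀ (V : Subset n) (is : Vec (Fin n) k) → ∣ support is ∣ ≡ k →
              ∣ support is ∩ V ∣ ≡ multiplicity V is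
∣support∩V∣ {n} V [] _ = trans (cong ∣_∣ (Subset.∩-zeroˡ V)) (Subset.∣⊥∣≡0 n)
∣support∩V∣ V (i ∷ is) ∣s∣≡k with i ∈? support is
... | yes i∈s = contradiction (∣support∣≤length is)
  (ℕ.<⇒≱ (ℕ.≤-reflexive (trans (sym ∣s∣≡k) (cong ∣_∣ (i∈s⇒⁅i⁆∪s≡s i∈s)))))
... | no  i∉s = trans (∣[⁅i⁆∪s]∩V∣ V i∉s)
  (cong (indicator V i +_) (∣support∩V∣ V is (ℕ.suc-injective (trans (sym (∣⁅i⁆∪s∣ i∉s)) ∣s∣≡k))))

-- Listing the vertices of an edge as an index tuple.

support-map-suc : ∀ (is : Vec (Fin n) k) → support (map suc is) ≡ false ∷ support is
support-map-suc []       = refl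
support-map-suc (i ∷ is) = cong (⁅ suc i ⁆ ∪_) (support-map-suc is)

enumeration : ∀ (s : Subset n) → ∣ s ∣ ≡ k → Σ[ is ∈ Vec (Fin n) k ] support is ≡ s
enumeration []          refl = [] , refl
enumeration (true ∷ s)  refl = let is , eq = enumeration s refl in
  zero ∷ map suc is ,
  trans (cong (⁅ zero ⁆ ∪_) (support-map-suc is)) (cong (true ∷_) (trans (Subset.∪-identityˡ _) eq))
enumeration (false ∷ s) refl = let is , eq = enumeration s refl in
  map suc is , trans (support-map-suc is) (cong (false ∷_) eq)

⁅i⁆∪[s-i] : ∀ {i} {s : Subset n} → i ∈ s → ⁅ i ⁆ ∪ (s - i) ≡ s
⁅i⁆∪[s-i] {i = i} {s} i∈s = Subset.⊆-antisym ∪⊆s s⊆∪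
  where
  ∪⊆s : ⁅ i ⁆ ∪ (s - i) ⊆ s
  ∪⊆s x∈ with Subset.x∈p∪q⁻ ⁅ i ⁆ (s - i) x∈
  ... | inj₁ x∈⁅i⁆ = subst (_∈ s) (sym (Subset.x∈⁅y⁆⇒x≡y i x∈⁅i⁆)) i∈s
  ... | inj₂ x∈s-i = Subset.p─q⊆p s ⁅ i ⁆ x∈s-i
  s⊆∪ : s ⊆ ⁅ i ⁆ ∪ (s - i)
  s⊆∪ {x} x∈s with x Fin.≟ i
  ... | yes refl = Subset.x∈p∪q⁺ (inj₁ (Subset.x∈⁅x⁆ i))
  ... | no  x≢i  = Subset.x∈p∪q⁺ (inj₂ (Subset.x∈p∧x≢y⇒x∈p-y x∈s x≢i))

i∉s-i : ∀ (s : Subset n) {i} → i ∉ s - i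
i∉s-i (_ ∷ s) {suc i} (there i∈) = i∉s-i s i∈

-- Any vertex of an edge can be the first index, the one that `scale` treats differently from the
-- others.
enumeration-from : ∀ {i} {s : Subset n} → i ∈ s → ∣ s ∣ ≡ suc k →
                   Σ[ is ∈ Vec (Fin n) k ] support (i ∷ is) ≡ s
enumeration-from {i = i} {s} i∈s ∣s∣≡1+k =
  let is , eq = enumeration (s - i) (ℕ.suc-injective
                  (trans (sym (∣⁅i⁆∪s∣ (i∉s-i s))) (trans (cong ∣_∣ (⁅i⁆∪[s-i] i∈s)) ∣s∣≡1+k)))
  in is , trans (cong (⁅ i ⁆ ∪_) eq) (⁅i⁆∪[s-i] i∈s)

-- Powers of -1.

sgn : ℕ → ℚ
sgn m = (ℚ.- 1ℚ) ^ m

sgn-even : ∀ {m} → 2 ∣ m → sgn m ≡ 1ℚ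
sgn-even (divides-refl zero)    = refl
sgn-even (divides-refl (suc q)) =
  cong (λ x → ℚ.- 1ℚ ℚ.* (ℚ.- 1ℚ ℚ.* x)) (sgn-even (divides-refl q))

sgn-odd : ∀ {m} → 2 ∤ m → sgn m ≡ ℚ.- 1ℚ
sgn-odd {zero}  2∤m = contradiction (divides 0 refl) 2∤m
sgn-odd {suc m} 2∤m =
  -- As `suc m` is odd, `2 + m` is even, and so is `m`.
  cong (ℚ.- 1ℚ ℚ.*_) (sgn-even (∣m+n∣m⇒∣n (2∤m⇒2∣1+m 2∤m) (divides 1 refl)))

sgn-homo-* : ∀ l m → sgn (l + m) ≡ sgn l ℚ.* sgn m
sgn-homo-* = Exp.^-homo-* (CommutativeRing.semiring ℚ.+-*-commutativeRing) (ℚ.- 1ℚ)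

sgn-^ : ∀ m l → sgn m ^ l ≡ sgn (m * l)
sgn-^ = Exp.^-assocʳ (CommutativeRing.semiring ℚ.+-*-commutativeRing) (ℚ.- 1ℚ)

1/sgn : ∀ b p .{{_ : ℚ.NonZero p}} → p ≡ sgn (if b then 1 else 0) → ℚ.1/ p ≡ p
1/sgn true  _ refl = refl
1/sgn false _ refl = refl

-- Sign matrices, their negative sets, and the sign produced by scaling.

record Negates (P : NonsingularDiagonal n) (V : Subset n) : Set where
  field
    diagonal≡sgn : ∀ i → diagonal P i ≡ sgn (indicator V i)

open Negates

negativeSet : NonsingularDiagonal n → Subset n
negativeSet P = tabulate λ i → does (diagonal P i ℚ.≟ ℚ.- 1ℚ)

negates-negativeSet : ∀ (P : NonsingularDiagonal n) → SignDiagonal P → Negates P (negativeSet P)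
negates-negativeSet P ± .diagonal≡sgn i
  rewrite lookup∘tabulate (λ i → does (diagonal P i ℚ.≟ ℚ.- 1ℚ)) i
  with diagonal P i ℚ.≟ ℚ.- 1ℚ | ± i
... | yes p≡-1 | _         = p≡-1
... | no  _    | inj₁ p≡1  = p≡1
... | no  p≢-1 | inj₂ p≡-1 = contradiction p≡-1 p≢-1

-- The tuple `i ∷ is` has length `suc k`, so `k` here is the order of the tensor minus one, the
-- power to which the inverse entry is raised.
exponent : Subset n → Fin n → Vec (Fin n) k → ℕ
exponent {k = k} V i is = indicator V i * k + multiplicity V is

module _ (P : NonsingularDiagonal n) {V : Subset n} (neg : Negates P V) where

  product-diagonal : ∀ (is : Vec (Fin n) k) →
                     foldr′ ℚ._*_ 1ℚ (map (diagonal P) is) ≡ sgn (multiplicity V is)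
  product-diagonal []       = refl
  product-diagonal (i ∷ is) =
    trans (cong₂ ℚ._*_ (diagonal≡sgn neg i) (product-diagonal is)) (sym (sgn-homo-* (indicator V i) _))

  -- Each sign is its own inverse, so all the factors are powers of -1 and their exponents add up.
  scale-sgn : ∀ T i (is : Vec (Fin n) k) → scale P T (i ∷ is) ≡ sgn (exponent V i is) ℚ.* T (i ∷ is)
  scale-sgn {k} T i is = cong (ℚ._* T (i ∷ is)) (begin
    diagonal⁻¹ P i ^ k ℚ.* foldr′ ℚ._*_ 1ℚ (map (diagonal P) is)
      ≡⟨ cong₂ (λ d p → d ^ k ℚ.* p)
           (trans (1/sgn (lookup V i) (diagonal P i) {{nonsingular P i}} (diagonal≡sgn neg i)) (diagonal≡sgn neg i))
           (product-diagonal is) ⟩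
    sgn (indicator V i) ^ k ℚ.* sgn (multiplicity V is)
      ≡⟨ cong (ℚ._* _) (sgn-^ (indicator V i) k) ⟩
    sgn (indicator V i * k) ℚ.* sgn (multiplicity V is)
      ≡⟨ sgn-homo-* (indicator V i * k) _ ⟨
    sgn (exponent V i is) ∎)
    where open ≡-Reasoning

-- Invariance of the degree tensor, and the equivalence of (1) and (2).

multiplicity-constant : ∀ (V : Subset n) {i} {is : Vec (Fin n) k} → All (i ≡_) is →
                        multiplicity V is ≡ k * indicator V i
multiplicity-constant V []          = refl
multiplicity-constant V (refl ∷ eq) = cong (_ +_) (multiplicity-constant V eq)

-- Off the diagonal both sides vanish. On it all indices equal `i`, and the exponent is twice
-- `k * indicator V i`.
degreeTensor-invariant : ∀ (G : Hypergraph (suc k) n) V i is →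
  degreeTensor G (i ∷ is) ≡ sgn (exponent V i is) ℚ.* degreeTensor G (i ∷ is)
degreeTensor-invariant {k} G V i is with all? (i Fin.≟_) is
... | no  _  = sym (ℚ.*-zeroʳ (sgn (exponent V i is)))
... | yes eq = sym (trans (cong (ℚ._* _) (sgn-even even)) (ℚ.*-identityˡ _))
  where
  even : 2 ∣ exponent V i is
  even = subst (2 ∣_) (cong₂ _+_ (ℕ.*-comm k _) (sym (multiplicity-constant V eq)))
           (2∣m+m (k * indicator V i))

p≢-p : ∀ p → ℚ.Positive p → p ≢ ℚ.- p
p≢-p (ℚ.mkℚ ℤ.+[1+ _ ] _ _) _ ()

open GroupProperties ℚ.+-0-group using (∙-cancelˡ; ⁻¹-involutive)

-- Since `x` fixes `d`, the right side is `d + xa`, and `d` cancels.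
d-a≡x[d+a]⇔a≡-xa : ∀ {x d a} → d ≡ x ℚ.* d → (d ℚ.- a ≡ x ℚ.* (d ℚ.+ a)) ⇔ (a ≡ ℚ.- (x ℚ.* a))
d-a≡x[d+a]⇔a≡-xa {x} {d} {a} d≡xd = mk⇔
  (λ eq → trans (sym (⁻¹-involutive a)) (cong ℚ.-_ (∙-cancelˡ d _ _ (trans eq x[d+a]≡d+xa))))
  (λ eq → trans (cong (d ℚ.+_) (trans (cong ℚ.-_ eq) (⁻¹-involutive (x ℚ.* a)))) (sym x[d+a]≡d+xa))
  where
  x[d+a]≡d+xa : x ℚ.* (d ℚ.+ a) ≡ d ℚ.+ x ℚ.* a
  x[d+a]≡d+xa = trans (ℚ.*-distribˡ-+ x d a) (cong (ℚ._+ x ℚ.* a) (sym d≡xd))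

laplacian⇔adjacency : ∀ (G : Hypergraph (suc k) n) P {V} → Negates P V →
  (laplacian G ≗ scale P (signlessLaplacian G)) ⇔ (adjacency G ≗ -ᵗ (scale P (adjacency G)))
laplacian⇔adjacency G P {V} neg = mk⇔
  (λ { eq (i ∷ is) → trans
         (to (entry i is) (trans (eq (i ∷ is)) (scale-sgn P neg (signlessLaplacian G) i is)))
         (cong ℚ.-_ (sym (scale-sgn P neg (adjacency G) i is))) })
  (λ { eq (i ∷ is) → trans
         (from (entry i is) (trans (eq (i ∷ is)) (cong ℚ.-_ (scale-sgn P neg (adjacency G) i is))))
         (sym (scale-sgn P neg (signlessLaplacian G) i is)) })
  where
  open Equivalence
  entry = λ i is → d-a≡x[d+a]⇔a≡-xa {sgn (exponent V i is)} {a = adjacency G (i ∷ is)} (degreeTensor-invariant G V i is)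

-- Condition (2) as a parity condition on edges.

OddExponents : Hypergraph (suc k) n → Subset n → Set
OddExponents {k} {n} G V =
  ∀ i (is : Vec (Fin n) k) → support (i ∷ is) List.∈ edges G → 2 ∤ exponent V i is

-- Off the edges both sides are zero. On an edge the entry is positive, hence differs from its
-- negative, so the equation forces the sign -1.
adjacency⇔oddExponents : ∀ (G : Hypergraph (suc k) n) P {V} → Negates P V →
  (adjacency G ≗ -ᵗ (scale P (adjacency G))) ⇔ OddExponents G V
adjacency⇔oddExponents {k} {n} G P {V} neg = mk⇔ odd reversed
  where
  instance _ = k !≢0

  adjacency-positive : ∀ is → support is List.∈ edges G → ℚ.Positive (adjacency G is)
  adjacency-positive is e∈ with isEdge? G (support is)
  ... | yes _  = ℚ.normalize-pos 1 (k !)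
  ... | no  e∉ = contradiction e∈ e∉

  odd : adjacency G ≗ -ᵗ (scale P (adjacency G)) → OddExponents G V
  odd eq i is e∈ even = p≢-p _ (adjacency-positive (i ∷ is) e∈) (trans (eq (i ∷ is)) (cong ℚ.-_ (begin
    scale P (adjacency G) (i ∷ is)                     ≡⟨ scale-sgn P neg (adjacency G) i is ⟩
    sgn (exponent V i is) ℚ.* adjacency G (i ∷ is)     ≡⟨ cong (ℚ._* _) (sgn-even even) ⟩
    1ℚ ℚ.* adjacency G (i ∷ is)                        ≡⟨ ℚ.*-identityˡ _ ⟩
    adjacency G (i ∷ is)                               ∎)))
    where open ≡-Reasoning

  entry : OddExponents G V → ∀ i is →
          adjacency G (i ∷ is) ≡ ℚ.- (sgn (exponent V i is) ℚ.* adjacency G (i ∷ is))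
  entry odds i is with isEdge? G (support (i ∷ is))
  ... | no  _  = sym (cong ℚ.-_ (ℚ.*-zeroʳ (sgn (exponent V i is))))
  ... | yes e∈ = sym (trans (ℚ.neg-distribˡ-* (sgn (exponent V i is)) _)
                   (trans (cong (λ x → ℚ.- x ℚ.* _) (sgn-odd (odds i is e∈))) (ℚ.*-identityˡ _)))

  reversed : OddExponents G V → adjacency G ≗ -ᵗ (scale P (adjacency G))
  reversed odds (i ∷ is) = trans (entry odds i is) (cong ℚ.-_ (sym (scale-sgn P neg (adjacency G) i is)))

-- Exponents versus intersection sizes, for even and for odd edge size.

exponent+multiplicity-even : ∀ (V : Subset n) i (is : Vec (Fin n) k) → 2 ∣ suc k →
                             2 ∣ exponent V i is + multiplicity V (i ∷ is)
exponent+multiplicity-even {k = k} V i is 2∣1+k =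
  -- The sum is `indicator V i * suc k` plus twice `multiplicity V is`.
  subst (2 ∣_) (rearrange (indicator V i) k (multiplicity V is))
    (∣m∣n⇒∣m+n (∣n⇒∣m*n (indicator V i) 2∣1+k) (2∣m+m (multiplicity V is)))
  where
  rearrange : ∀ b k w → b * suc k + (w + w) ≡ (b * k + w) + (b + w)
  rearrange = solve-∀

module _ (G : Hypergraph (suc k) n) (V : Subset n) where

  ∣edge∩V∣ : ∀ i (is : Vec (Fin n) k) {e} → support (i ∷ is) ≡ e → e List.∈ edges G →
             ∣ e ∩ V ∣ ≡ indicator V i + multiplicity V is
  ∣edge∩V∣ i is refl e∈ = ∣support∩V∣ V (i ∷ is) (edges-uniform G e∈)

  -- For even `k` the term `indicator V i * k` drops out modulo 2, so the number `w` of vertices of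
  -- `e` in `V` other than `i` is odd, whichever vertex `i` of `e` comes first.
  edge-from : ∀ {i e} → i ∈ e → e List.∈ edges G → 2 ∣ k → OddExponents G V →
              ∃[ w ] (2 ∤ w × ∣ e ∩ V ∣ ≡ indicator V i + w)
  edge-from {i} i∈e e∈ 2∣k odds =
    let is , eq = enumeration-from i∈e (edges-uniform G e∈) in
    multiplicity V is ,
    (λ even → odds i is (subst (List._∈ edges G) (sym eq) e∈)
                (∣m∣n⇒∣m+n (∣n⇒∣m*n (indicator V i) 2∣k) even)) ,
    ∣edge∩V∣ i is eq e∈

  -- For even k (edges of odd size k + 1) the sign of every i in an edge e is
  -- minus the product of the signs in e; the signs in e are thus all equal
  -- to some c, and c = - c^(k+1) = - c is absurd.
  odd-uniform⇒edgeless : 2 ∣ k → OddExponents G V → ∀ {e} → ¬ (e List.∈ edges G)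
  odd-uniform⇒edgeless 2∣k odds {e} e∈ with 2 ∣? ∣ e ∩ V ∣
  -- A vertex of `e` outside `V` would make `∣ e ∩ V ∣` equal to the odd `w`. So `e` lies in `V`,
  -- and its size `k + 1` is even along with `k`.
  ... | yes even = case ∣1⇒≡1 2∣1 of λ ()
    where
    e⊆V : e ⊆ V
    e⊆V {i} i∈e with i ∈? V | edge-from i∈e e∈ 2∣k odds
    ... | yes i∈V | _           = i∈V
    ... | no  i∉V | w , 2∤w , eq =
      contradiction (subst (2 ∣_) (trans eq (cong (_+ w) (indicator-∉ i∉V))) even) 2∤w
    e∩V≡e : e ∩ V ≡ e
    e∩V≡e = Subset.⊆-antisym (Subset.p∩q⊆p e V) (λ i∈e → Subset.x∈p∩q⁺ (i∈e , e⊆V i∈e))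
    2∣1 : 2 ∣ 1
    2∣1 = ∣m+n∣m⇒∣n
      (subst (2 ∣_) (trans (cong ∣_∣ e∩V≡e) (trans (edges-uniform G e∈) (ℕ.+-comm 1 k))) even) 2∣k
  -- A vertex of `e` in `V` would make `∣ e ∩ V ∣` equal to `1 + w`, which is even. So the
  -- intersection is empty, and 0 is not odd.
  ... | no odd = odd (subst (2 ∣_) (sym ∣e∩V∣≡0) (divides 0 refl))
    where
    empty : ∀ {i} → i ∉ e ∩ V
    empty i∈e∩V with i∈e , i∈V ← Subset.x∈p∩q⁻ e V i∈e∩V
      with w , 2∤w , eq ← edge-from i∈e e∈ 2∣k odds
      = odd (subst (2 ∣_) (sym (trans eq (cong (_+ w) (indicator-∈ i∈V)))) (2∤m⇒2∣1+m 2∤w))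
    ∣e∩V∣≡0 : ∣ e ∩ V ∣ ≡ 0
    ∣e∩V∣≡0 = trans (cong ∣_∣ (Subset.Empty-unique (empty ∘ proj₂))) (Subset.∣⊥∣≡0 n)

  -- On each edge the exponent and the intersection size have an even sum, hence the same parity.
  oddExponents⇔oddIntersections : 2 ∣ suc k →
    OddExponents G V ⇔ (∀ {e} → e List.∈ edges G → 2 ∤ ∣ e ∩ V ∣)
  oddExponents⇔oddIntersections 2∣1+k = mk⇔ intersections exponents
    where
    intersections : OddExponents G V → ∀ {e} → e List.∈ edges G → 2 ∤ ∣ e ∩ V ∣
    intersections odds {e} e∈ even with enumeration e (edges-uniform G e∈)
    ... | i ∷ is , eq = odds i is (subst (List._∈ edges G) (sym eq) e∈)
      (∣m+n∣m⇒∣n (subst (2 ∣_) (ℕ.+-comm (exponent V i is) (multiplicity V (i ∷ is)))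
                   (exponent+multiplicity-even V i is 2∣1+k))
        (subst (2 ∣_) (∣edge∩V∣ i is eq e∈) even))
    exponents : (∀ {e} → e List.∈ edges G → 2 ∤ ∣ e ∩ V ∣) → OddExponents G V
    exponents odds i is e∈ even = odds e∈ (subst (2 ∣_) (sym (∣edge∩V∣ i is refl e∈))
      (∣m+n∣m⇒∣n (exponent+multiplicity-even V i is 2∣1+k) even))

-- Evenness of the edge size from connectedness.

connected⇒edge : ∀ (G : Hypergraph k n) → 2 ≤ n → Connected G → Edge G
connected⇒edge G (s≤s (s≤s _)) connected = proj₁ (connected zero (suc zero) λ ())

-- If `suc k` were odd, odd exponents would exclude all edges, but a path joining two distinct
-- vertices starts with one.
even-uniform : ∀ (G : Hypergraph (suc k) n) V → Connected G → (2 ≤ n) ⊎ (2 ∣ suc k) →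
               OddExponents G V → 2 ∣ suc k
even-uniform     G V connected (inj₂ 2∣1+k) odds = 2∣1+k
even-uniform {k} G V connected (inj₁ 2≤n)   odds with 2∣m⊎2∣1+m k
... | inj₁ 2∣k   = contradiction (proj₂ (connected⇒edge G 2≤n connected)) (odd-uniform⇒edgeless G V 2∣k odds)
... | inj₂ 2∣1+k = 2∣1+k

-- The sign matrix of a vertex set, and properness of the set.

signMatrix : Subset n → NonsingularDiagonal n
signMatrix V .matrix i j = if does (i Fin.≟ j) then sgn (indicator V i) else 0ℚ
signMatrix V .off-diagonal {i} {j} i≢j = cong (if_then sgn (indicator V i) else 0ℚ) (dec-false (i Fin.≟ j) i≢j)
signMatrix V .nonsingular i
  rewrite dec-true (i Fin.≟ i) refl with lookup V i
... | true  = _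
... | false = _

negates-signMatrix : ∀ (V : Subset n) → Negates (signMatrix V) V
negates-signMatrix V .diagonal≡sgn i = cong (if_then sgn (indicator V i) else 0ℚ) (dec-true (i Fin.≟ i) refl)

identity-diagonal : ∀ (i : Fin n) → identity i i ≡ 1ℚ
identity-diagonal i = cong (if_then 1ℚ else 0ℚ) (dec-true (i Fin.≟ i) refl)

negates⇒signDiagonal : ∀ (P : NonsingularDiagonal n) {V} → Negates P V → SignDiagonal P
negates⇒signDiagonal P {V} neg i with lookup V i | diagonal≡sgn neg i
... | true  | eq = inj₂ eq
... | false | eq = inj₁ eq

≉-I⇔⊂⊤ : ∀ (P : NonsingularDiagonal n) {V} → Negates P V → (¬ (matrix P ≈ᴹ -ᴹ identity)) ⇔ (V ⊂ ⊤)
≉-I⇔⊂⊤ {n} P {V} neg = mk⇔ proper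
  (λ { (_ , i , _ , i∉V) P≈-I → case (begin
         1ℚ                    ≡⟨ cong sgn (indicator-∉ i∉V) ⟨
         sgn (indicator V i)   ≡⟨ diagonal≡sgn neg i ⟨
         diagonal P i          ≡⟨ P≈-I i i ⟩
         ℚ.- identity i i      ≡⟨ cong ℚ.-_ (identity-diagonal i) ⟩
         ℚ.- 1ℚ                ∎) of λ () })
  where
  open ≡-Reasoning
  ≈-I : (∀ i → i ∈ V) → matrix P ≈ᴹ -ᴹ identity
  ≈-I all i j with i Fin.≟ j
  ... | yes refl = trans (diagonal≡sgn neg i) (cong sgn (indicator-∈ (all i)))
  ... | no  i≢j  = off-diagonal P i≢j
  proper : ¬ (matrix P ≈ᴹ -ᴹ identity) → V ⊂ ⊤
  -- Membership in `V` is decidable and `Fin n` is finite, so refuting that every vertex lies in `V`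
  -- yields an explicit vertex outside.
  proper P≉-I = let i , i∉V = Fin.¬∀⟶∃¬ n (_∈ V) (_∈? V) (P≉-I ∘ ≈-I) in
    (λ _ → Subset.∈⊤) , i , Subset.∈⊤ , i∉V

theorem2p1 : ∀ (k n : ℕ) → 2 ≤ k → (G : Hypergraph k n) → Connected G →
    -- excludes only n = 1 with k odd, where G is edgeless, (1) and (2) hold and (3) fails
    2 ≤ n ⊎ 2 ∣ k →
    let cond1 = ∃[ P ] (SignDiagonal P × ¬ (matrix P ≈ᴹ -ᴹ identity) × laplacian G ≗ scale P (signlessLaplacian G))
        cond2 = ∃[ P ] (SignDiagonal P × ¬ (matrix P ≈ᴹ -ᴹ identity) × adjacency G ≗ -ᵗ (scale P (adjacency G)))
        cond3 = 2 ∣ k × OddBipartite G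
    in (cond1 ⇔ cond2) × (cond2 ⇔ cond3) × (cond1 ⇔ cond3)
-- From here on `k` is one less than the edge size; size 0 is excluded by `2 ≤ k`.
theorem2p1 (suc k) n _ G connected 2≤n⊎2∣1+k = 1⇔2 , 2⇔3 , 2⇔3 ⇔-∘ 1⇔2
  where
  open Equivalence

  1⇔2 = mk⇔
    (λ { (P , ± , P≉-I , eq) → P , ± , P≉-I , to (laplacian⇔adjacency G P (negates-negativeSet P ±)) eq })
    (λ { (P , ± , P≉-I , eq) → P , ± , P≉-I , from (laplacian⇔adjacency G P (negates-negativeSet P ±)) eq })

  2⇔3 = mk⇔
    (λ { (P , ± , P≉-I , eq) →
         let neg   = negates-negativeSet P ±
             odds  = to (adjacency⇔oddExponents G P neg) eq
             2∣1+k = even-uniform G (negativeSet P) connected 2≤n⊎2∣1+k odds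
         in 2∣1+k , 2∣1+k , negativeSet P , to (≉-I⇔⊂⊤ P neg) P≉-I ,
            to (oddExponents⇔oddIntersections G (negativeSet P) 2∣1+k) odds })
    (λ { (2∣1+k , _ , V , V⊂⊤ , odds) →
         let P   = signMatrix V
             neg = negates-signMatrix V
         in P , negates⇒signDiagonal P neg , from (≉-I⇔⊂⊤ P neg) V⊂⊤ ,
            from (adjacency⇔oddExponents G P neg) (from (oddExponents⇔oddIntersections G V 2∣1+k) odds) })
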